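{- Let $n = p_1^{\alpha_1} p_2^{\alpha_2}\cdots p_s^{\alpha_s}$ be the prime power factorization of $n$, where $s \geq 1$, $p_1 < p_2 < \cdots < p_s$ are distinct primes and $\alpha_i \geq 1$ for all $1 \leq i \leq s$. Let $G(\mathbb{Z}_n)$ be the zero-divisor graph of $\mathbb{Z}_n$, with vertex set $\mathbb{Z}_n \setminus \{0\}$. Then: (1) If $n$ is square-free, the clique number of $G(\mathbb{Z}_n)$ is $s$. (2) If $\alpha_i$ is even for all $1 \leq i \leq s$, the clique number of $G(\mathbb{Z}_n)$ is $p_1^{\alpha_1/2} p_2^{\alpha_2/2} \cdots p_s^{\alpha_s/2} - 1$. (3) Otherwise, write $n = \ell_1^{\delta_1}\cdots \ell_r^{\delta_r}\, q_1^{\beta_1}\cdots q_t^{\beta_t}$, where $\ell_1,\dots,\ell_r$ (with $r \geq 0$) are the distinct primes dividing $n$ to an even exponent, $\delta_i$ being the (positive, even) exponent of $\ell_i$ for $i = 1,\dots,r$, and $q_1,\dots,q_t$ (with $t \geq 1$) are the distinct primes dividing $n$ to an odd exponent, $\beta_j$ being the (odd) exponent of $q_j$ for $j=1,\dots,t$. Then the clique number of $G(\mathbb{Z}_n)$ is $$\ell_1^{\delta_1/2}\cdots \ell_r^{\delta_r/2}\, q_1^{(\beta_1-1)/2}\cdots q_t^{(\beta_t-1)/2} + t - 1.$$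
   Context: The zero-divisor graph $G(\mathbb{Z}_n)$ of the ring $\mathbb{Z}_n$ of integers modulo $n$ is the simple graph whose vertex set is $\mathbb{Z}_n \setminus \{0\}$ (all nonzero elements, not only the zero-divisors), in which two vertices $x$ and $y$ are adjacent if and only if $x \neq y$ and $x\cdot y \equiv 0 \pmod n$. A clique in a graph is a complete subgraph (any two distinct vertices in it are adjacent), and the clique number of a graph is the order (number of vertices) of its largest clique. An empty product equals $1$. -}

module Defs where

open import Level using (Level; 0ℓ; _⊔_) renaming (suc to lsuc)
open import Data.Nat.Base using (ℕ; suc; _*_; _^_; _≤_)
open import Data.Nat.Divisibility using (_∣_)
open import Data.Nat.Primality using (Prime)
open import Data.Nat.Properties using (*-comm)
open import Data.Nat.ListAction using (product)
open import Data.Fin.Base using (Fin; toℕ)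
open import Data.List.Base using (List; length; tabulate)
open import Data.List.Membership.Propositional using (_∈_)
open import Data.List.Relation.Unary.Unique.Propositional using (Unique)
open import Data.Product.Base using (Σ-syntax; ∃-syntax; _×_; _,_; proj₁)
open import Relation.Nullary.Negation.Core using (¬_)
open import Relation.Binary.Core using (Rel)
open import Relation.Binary.Definitions using (Symmetric)
open import Relation.Binary.PropositionalEquality
  using (_≡_; _≢_; refl; sym; subst)
open import Function.Definitions using (Injective)

record SimpleGraph (a ℓ : Level) : Set (lsuc (a ⊔ ℓ)) where
  field
    Vertex     : Set a
    _~_        : Rel Vertex ℓ
    ~-sym      : Symmetric _~_
    ~-loopless : ∀ {x} → ¬ (x ~ x)

module _ {a ℓ} (G : SimpleGraph a ℓ) where
  open SimpleGraph G

  -- A finite set of vertices is given by a duplicate-free list, so that its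
  -- order is the length of the list.
  record IsClique (c : List Vertex) : Set (a ⊔ ℓ) where
    field
      unique   : Unique c
      adjacent : ∀ {x y} → x ∈ c → y ∈ c → x ≢ y → x ~ y

  record IsCliqueNumber (k : ℕ) : Set (a ⊔ ℓ) where
    field
      attained : ∃[ c ] IsClique c × length c ≡ k
      maximal  : ∀ {c} → IsClique c → length c ≤ k

-- Residues modulo n are represented by Fin n. Since ⊥ is proof-irrelevant in
-- the library, two vertices are equal as soon as the residues are.
NonZeroResidue : ℕ → Set
NonZeroResidue n = Σ[ x ∈ Fin n ] toℕ x ≢ 0

residue-injective : ∀ {n} → Injective {A = NonZeroResidue n} _≡_ _≡_ proj₁
residue-injective refl = refl

zeroDivisorGraph : ℕ → SimpleGraph 0ℓ 0ℓ
zeroDivisorGraph n = record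
  { Vertex     = NonZeroResidue n
  ; _~_        = λ x y → x ≢ y × n ∣ toℕ (proj₁ x) * toℕ (proj₁ y)
  ; ~-sym      = λ { {x} {y} (x≢y , n∣xy) →
                     (λ y≡x → x≢y (sym y≡x))
                   , subst (n ∣_) (*-comm (toℕ (proj₁ x)) (toℕ (proj₁ y))) n∣xy }
  ; ~-loopless = λ (x≢x , _) → x≢x refl
  }

∏ : ∀ {k} → (Fin k → ℕ) → ℕ
∏ f = product (tabulate f)

Even Odd : ℕ → Set
Even m = 2 ∣ m
Odd m = ¬ Even m

SquareFree : ℕ → Set
SquareFree n = ∀ {d} → d * d ∣ n → d ≡ 1

_^_∥_ : ℕ → ℕ → ℕ → Set
p ^ e ∥ n = p ^ e ∣ n × ¬ (p ^ suc e ∣ n)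

-- p lists, without repetition, exactly the primes that divide n to an
-- exponent satisfying P, and e gives their exponents.
record PrimesWithExponent (P : ℕ → Set) (n : ℕ) {k : ℕ}
                          (p e : Fin k → ℕ) : Set where
  field
    prime    : ∀ i → Prime (p i)
    distinct : Injective _≡_ _≡_ p
    positive : ∀ i → 1 ≤ e i
    exponent : ∀ i → p i ^ e i ∥ n
    property : ∀ i → P (e i)
    complete : ∀ {q d} → Prime q → 1 ≤ d → q ^ d ∥ n → P d → ∃[ i ] p i ≡ q

{-# OPTIONS --safe #-}
module Submission where

-- Write n = A * (A * B), where B is the product of the primes of odd exponent
-- and A is the largest number whose square divides n, and put M = A * B.
-- All three formulas say that the clique number is (A - 1) + t, where t is
-- the number of primes q dividing B: in the square-free case A = 1, and in
-- the case of even exponents B = 1 and t = 0.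
--
-- A clique of this order consists of the A - 1 nonzero multiples of M, and of
-- the t residues A * (B / q). Indeed n divides M * M, it divides
-- M * (A * (B / q)), and it divides A * (B / q) * (A * (B / q')) for q
-- different from q', because then q' divides B / q (val-adjacent).
--
-- No clique is larger because the graph has a proper colouring with as many
-- colours (HasColour, proper, coloured). The colours are the nonzero multiples
-- of M and the primes dividing B. A multiple of M is its own colour. Any other
-- x fails to be divisible by the full power in M of some prime. If this is a
-- prime q of odd exponent, then q is the colour of x. If it is a prime l of
-- even exponent 2k, the colour of x is the multiple M * (A / l ^ k), in which
-- l has exponent exactly k. Two different vertices of the same colour are
-- never adjacent: the exponent in their product of the prime in question is
-- too small (primePower-split).

open import Defs
open import Data.Nat.Base using (ℕ; zero; suc; _+_; _*_; _∸_; _^_; _/_; _≤_; _<_; z≤n;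
  s≤s; NonZero; >-nonZero; >-nonZero⁻¹; ≢-nonZero; ≢-nonZero⁻¹; nonTrivial⇒n>1;
  nonTrivial⇒≢1)
open import Data.Nat.Divisibility using (_∣_; _∤_; divides; _∣?_; quotient; ∣-trans;
  ∣-refl; ∣-reflexive; ∣1⇒≡1; m∣m*n; n∣m*n; ∣m⇒∣m*n; *-pres-∣; *-monoˡ-∣; *-monoʳ-∣;
  *-cancelˡ-∣; *-cancelʳ-∣; 1∣_; ∣m∣n⇒∣m+n)
open import Data.Nat.DivMod using (m/n*n≡m)
open import Data.Nat.ListAction using (product)
open import Data.Nat.ListAction.Properties using (∈⇒∣product; product≢0)
open import Data.Nat.Primality using (Prime; euclidsLemma; prime⇒irreducible;
  prime⇒nonZero; prime⇒nonTrivial)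
open import Data.Nat.Properties using (*-comm; *-assoc; *-identityˡ; *-identityʳ;
  +-identityʳ; +-∸-comm; *-cancelˡ-≡; *-cancelʳ-≡; *-cancelʳ-<; *-monoʳ-<; m*n≢0;
  m*n≢0⇒m≢0; m^n≢0; m<m*n; m≤n*m; <-cmp; ^-monoʳ-<; suc-injective; <-≤-trans; ≤-pred;
  ^-distribˡ-+-*; suc-pred)
import Data.Nat.Properties as ℕ
open import Data.Nat.Solver using (module +-*-Solver)
open import Data.Fin.Base as Fin using (Fin; zero; suc; toℕ; fromℕ<; punchIn)
open import Data.Fin.Properties using (_≟_; all?; ¬∀⟶∃¬; injective⇒≤; toℕ<n;
  toℕ-injective; toℕ-fromℕ<; punchInᵢ≢i; +↔⊎)
import Data.Fin.Properties as Fin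
open import Data.List.Base using (List; length; lookup; tabulate)
open import Data.List.Membership.Propositional.Properties using (∈-tabulate⁺;
  ∈-tabulate⁻; ∈-lookup)
open import Data.List.Properties using (tabulate-cong; length-tabulate)
open import Data.List.Relation.Unary.All as All using (All)
import Data.List.Relation.Unary.All.Properties as All
open import Data.List.Relation.Unary.AllPairs using (_∷_)
open import Data.List.Relation.Unary.Unique.Propositional using (Unique)
import Data.List.Relation.Unary.Unique.Propositional.Properties as Unique
open import Data.Product.Base using (_×_; _,_; proj₁; proj₂; ∃; ∃-syntax)
open import Data.Sum.Base using (_⊎_; inj₁; inj₂; [_,_]′)
open import Function.Base using (_∘_; id)
open import Function.Bundles using (_↔_; module Inverse)
open import Function.Definitions using (Injective)
open import Relation.Binary.Definitions using (tri<; tri≈; tri>)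
open import Relation.Binary.PropositionalEquality using (_≡_; _≢_; refl; sym; trans;
  cong; cong₂; subst; subst₂; module ≡-Reasoning)
open import Relation.Nullary.Decidable using (yes; no)
open import Relation.Nullary.Negation.Core using (¬_; contradiction)

-- Cliques and colourings

lookup-injective : ∀ {a} {V : Set a} {c : List V} → Unique c →
  ∀ {i j} → lookup c i ≡ lookup c j → i ≡ j
lookup-injective (_ ∷ _)   {zero}  {zero}  _  = refl
lookup-injective (x∉ ∷ _)  {zero}  {suc j} eq =
  contradiction eq (All.lookup x∉ (∈-lookup j))
lookup-injective (x∉ ∷ _)  {suc i} {zero}  eq =
  contradiction (sym eq) (All.lookup x∉ (∈-lookup i))
lookup-injective (_ ∷ uniq) {suc i} {suc j} eq =
  cong suc (lookup-injective uniq eq)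

module _ {a b e} (G : SimpleGraph a e) {K : ℕ} {C : Set b} (C↔K : Fin K ↔ C) where
  open SimpleGraph G
  open Inverse C↔K using (to; from; inverseˡ; inverseʳ)
  open IsClique

  private
    to-injective : ∀ {i j} → to i ≡ to j → i ≡ j
    to-injective eq = trans (sym (inverseʳ refl)) (inverseʳ eq)

    from-injective : ∀ {i j} → from i ≡ from j → i ≡ j
    from-injective eq = trans (sym (inverseˡ refl)) (inverseˡ eq)

  -- A clique indexed by C, together with a proper colouring by C, determines
  -- the clique number.
  cliqueNumber-colouring : (f : C → Vertex) (colour : Vertex → C) →
    (∀ {κ κ′} → κ ≢ κ′ → f κ ~ f κ′) →
    (∀ {x y} → colour x ≡ colour y → ¬ (x ~ y)) →
    IsCliqueNumber G K
  cliqueNumber-colouring f colour f-adjacent proper = record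
    { attained = tabulate g , g-clique , length-tabulate g
    ; maximal  = bound
    }
    where
    g : Fin K → Vertex
    g = f ∘ to

    g-injective : ∀ {i j} → g i ≡ g j → i ≡ j
    g-injective {i} {j} eq with i ≟ j
    ... | yes i≡j = i≡j
    ... | no  i≢j = contradiction
      (subst (g i ~_) (sym eq) (f-adjacent (i≢j ∘ to-injective))) ~-loopless

    g-clique : IsClique G (tabulate g)
    g-clique .unique = Unique.tabulate⁺ g-injective
    g-clique .adjacent x∈ y∈ x≢y with ∈-tabulate⁻ x∈ | ∈-tabulate⁻ y∈
    ... | i , refl | j , refl = f-adjacent (λ eq → x≢y (cong f eq))

    bound : ∀ {c} → IsClique G c → length c ≤ K
    bound {c} clique = injective⇒≤ {f = from ∘ colour ∘ lookup c} inj
      where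
      inj : ∀ {i j} → from (colour (lookup c i)) ≡ from (colour (lookup c j)) → i ≡ j
      inj {i} {j} eq with i ≟ j
      ... | yes i≡j = i≡j
      ... | no  i≢j = contradiction
        (clique .adjacent (∈-lookup i) (∈-lookup j)
          (i≢j ∘ lookup-injective (clique .unique)))
        (proper (from-injective eq))

-- Finite products

∏-cong : ∀ {k} {f g : Fin k → ℕ} → (∀ i → f i ≡ g i) → ∏ f ≡ ∏ g
∏-cong eq = cong product (tabulate-cong eq)

∏-* : ∀ {k} (f g : Fin k → ℕ) → ∏ (λ i → f i * g i) ≡ ∏ f * ∏ g
∏-* {zero}  f g = refl
∏-* {suc k} f g = trans
  (cong (f zero * g zero *_) (∏-* (f ∘ suc) (g ∘ suc)))
  (solve 4 (λ a b c d → a :* b :* (c :* d) := a :* c :* (b :* d)) refl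
    (f zero) (g zero) (∏ (f ∘ suc)) (∏ (g ∘ suc)))
  where open +-*-Solver

∏-1 : ∀ k → ∏ {k} (λ _ → 1) ≡ 1
∏-1 zero    = refl
∏-1 (suc k) = trans (*-identityˡ _) (∏-1 k)

∏-nonZero : ∀ {k} {f : Fin k → ℕ} → (∀ i → NonZero (f i)) → NonZero (∏ f)
∏-nonZero f≢0 = product≢0 (All.tabulate⁺ f≢0)

∣∏ : ∀ {k} (f : Fin k → ℕ) i → f i ∣ ∏ f
∣∏ f i = ∈⇒∣product (∈-tabulate⁺ i)

∏-punchIn : ∀ {k} (f : Fin (suc k) → ℕ) i → ∏ f ≡ f i * ∏ (f ∘ punchIn i)
∏-punchIn         f zero    = refl
∏-punchIn {suc k} f (suc i) = trans
  (cong (f zero *_) (∏-punchIn (f ∘ suc) i))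
  (solve 3 (λ a b c → a :* (b :* c) := b :* (a :* c)) refl
    (f zero) (f (suc i)) (∏ (f ∘ suc ∘ punchIn i)))
  where open +-*-Solver

-- Primes and their powers

prime-≢1 : ∀ {p} → Prime p → p ≢ 1
prime-≢1 pr = nonTrivial⇒≢1 {{prime⇒nonTrivial pr}}

prime^-nonZero : ∀ {p} → Prime p → ∀ e → NonZero (p ^ e)
prime^-nonZero {p} pr e = m^n≢0 p e {{prime⇒nonZero pr}}

prime∣prime⇒≡ : ∀ {p q} → Prime p → Prime q → p ∣ q → p ≡ q
prime∣prime⇒≡ p-prime q-prime p∣q =
  [ (λ p≡1 → contradiction p≡1 (prime-≢1 p-prime)) , id ]′
    (prime⇒irreducible q-prime p∣q)

prime∣^⇒∣ : ∀ {p m} → Prime p → ∀ e → p ∣ m ^ e → p ∣ m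
prime∣^⇒∣ pr zero    p∣1 = contradiction (∣1⇒≡1 p∣1) (prime-≢1 pr)
prime∣^⇒∣ {m = m} pr (suc e) p∣ =
  [ id , prime∣^⇒∣ pr e ]′ (euclidsLemma m (m ^ e) pr p∣)

prime∣∏⇒∣ : ∀ {p k} → Prime p → (f : Fin k → ℕ) → p ∣ ∏ f → ∃[ i ] p ∣ f i
prime∣∏⇒∣ {k = zero}  pr f p∣1 = contradiction (∣1⇒≡1 p∣1) (prime-≢1 pr)
prime∣∏⇒∣ {k = suc k} pr f p∣ with euclidsLemma (f zero) (∏ (f ∘ suc)) pr p∣
... | inj₁ p∣f₀ = zero , p∣f₀
... | inj₂ p∣∏ with i , p∣fᵢ ← prime∣∏⇒∣ pr (f ∘ suc) p∣∏ = suc i , p∣fᵢ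

^-monoʳ-∣ : ∀ p {d e} → d ≤ e → p ^ d ∣ p ^ e
^-monoʳ-∣ p z≤n     = 1∣ _
^-monoʳ-∣ p (s≤s d≤e) = *-monoʳ-∣ p (^-monoʳ-∣ p d≤e)

-- The exponent of a prime is determined by the number.
∥-unique : ∀ {p n d e} → p ^ d ∥ n → p ^ e ∥ n → d ≡ e
∥-unique {p} {d = d} {e} (pᵈ∣n , pᵈ⁺¹∤n) (pᵉ∣n , pᵉ⁺¹∤n) with <-cmp d e
... | tri< d<e _ _ = contradiction (∣-trans (^-monoʳ-∣ p d<e) pᵉ∣n) pᵈ⁺¹∤n
... | tri≈ _ d≡e _ = d≡e
... | tri> _ _ d>e = contradiction (∣-trans (^-monoʳ-∣ p d>e) pᵈ∣n) pᵉ⁺¹∤n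

primePower-∣ : ∀ {p} → Prime p → ∀ e x {y} → p ∤ x → p ^ e ∣ x * y → p ^ e ∣ y
primePower-∣ pr zero    x p∤x _ = 1∣ _
primePower-∣ {p} pr (suc e) x {y} p∤x p∣xy
  with euclidsLemma x y pr (∣-trans (m∣m*n (p ^ e)) p∣xy)
... | inj₁ p∣x = contradiction p∣x p∤x
... | inj₂ (divides z refl) = subst (p ^ suc e ∣_) (*-comm p z)
  (*-monoʳ-∣ p (primePower-∣ pr e x p∤x (*-cancelˡ-∣ p {{prime⇒nonZero pr}}
    (subst (p ^ suc e ∣_)
      (solve 3 (λ x z p → x :* (z :* p) := p :* (x :* z)) refl x z p) p∣xy))))
  where open +-*-Solver

-- If p has exponent at most i in x and at most j in y, then p has exponent at
-- most i + j in x * y.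
primePower-split : ∀ {p} → Prime p → ∀ i j x {y} →
  p ^ i * p ^ suc j ∣ x * y → p ^ suc i ∣ x ⊎ p ^ suc j ∣ y
primePower-split {p} pr i j x {y} p∣xy with p ∣? x
... | no  p∤x = inj₂ (primePower-∣ pr (suc j) x p∤x (∣-trans (n∣m*n (p ^ i)) p∣xy))
primePower-split {p} pr zero j x p∣xy | yes p∣x =
  inj₁ (subst (_∣ x) (sym (*-identityʳ p)) p∣x)
primePower-split {p} pr (suc i) j _ {y} p∣xy | yes (divides z refl) =
  [ (λ p∣z → inj₁ (subst (p ^ suc (suc i) ∣_) (*-comm p z) (*-monoʳ-∣ p p∣z))) , inj₂ ]′
    (primePower-split pr i j z (*-cancelˡ-∣ p {{prime⇒nonZero pr}} p∣p[zy]))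
  where
  open +-*-Solver
  p∣p[zy] : p * (p ^ i * p ^ suc j) ∣ p * (z * y)
  p∣p[zy] = subst₂ _∣_ (*-assoc p (p ^ i) (p ^ suc j))
    (solve 3 (λ z p y → z :* p :* y := p :* (z :* y)) refl z p y) p∣xy

module _ {s : ℕ} {p : Fin s → ℕ} (p-prime : ∀ i → Prime (p i)) where

  prime∣∏^⇒≡ : ∀ {q} → Prime q → (e : Fin s → ℕ) →
    q ∣ ∏ (λ i → p i ^ e i) → ∃[ i ] q ≡ p i
  prime∣∏^⇒≡ q-prime e q∣ with i , q∣pᵉ ← prime∣∏⇒∣ q-prime (λ i → p i ^ e i) q∣ =
    i , prime∣prime⇒≡ q-prime (p-prime i) (prime∣^⇒∣ q-prime (e i) q∣pᵉ)

  ∏^-nonZero : (e : Fin s → ℕ) → NonZero (∏ (λ i → p i ^ e i))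
  ∏^-nonZero e = ∏-nonZero (λ i → prime^-nonZero (p-prime i) (e i))

-- In a product of powers of distinct primes, each prime has the exponent
-- displayed.
∏^-cofactor : ∀ {s} {p : Fin s → ℕ} → (∀ i → Prime (p i)) → Injective _≡_ _≡_ p →
  (e : Fin s → ℕ) → ∀ i →
  ∃[ c ] ∏ (λ j → p j ^ e j) ≡ p i ^ e i * c × p i ∤ c
∏^-cofactor {suc s} {p} p-prime p-inj e i =
  ∏ (λ j → p (punchIn i j) ^ e (punchIn i j)) , ∏-punchIn (λ j → p j ^ e j) i , pᵢ∤
  where
  pᵢ∤ : p i ∤ ∏ (λ j → p (punchIn i j) ^ e (punchIn i j))
  pᵢ∤ pᵢ∣ with j , pᵢ≡pⱼ ← prime∣∏^⇒≡ (p-prime ∘ punchIn i) (p-prime i) (e ∘ punchIn i) pᵢ∣ =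
    punchInᵢ≢i i j (sym (p-inj pᵢ≡pⱼ))

-- A common multiple of pairwise coprime numbers, all but one of which are
-- prime powers, is a multiple of their product.
∏^-∣ : ∀ {s} {p : Fin s → ℕ} → (∀ i → Prime (p i)) → Injective _≡_ _≡_ p →
  (e : Fin s → ℕ) → ∀ {x y} → y ∣ x → (∀ i → p i ∤ y) →
  (∀ i → p i ^ e i ∣ x) → y * ∏ (λ i → p i ^ e i) ∣ x
∏^-∣ {zero} p-prime p-inj e {x} {y} y∣x p∤y pᵉ∣x = subst (_∣ x) (sym (*-identityʳ y)) y∣x
∏^-∣ {suc s} {p} p-prime p-inj e {x} {y} (divides z refl) p∤y pᵉ∣x =
  subst (_∣ x) (*-assoc y (p zero ^ e zero) _)
    (∏^-∣ (p-prime ∘ suc) (Fin.suc-injective ∘ p-inj) (e ∘ suc) yp₀∣x p∤yp₀ (pᵉ∣x ∘ suc))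
  where
  yp₀∣x : y * p zero ^ e zero ∣ z * y
  yp₀∣x = subst (y * p zero ^ e zero ∣_) (*-comm y z)
    (*-monoʳ-∣ y (primePower-∣ (p-prime zero) (e zero) y (p∤y zero)
      (subst (p zero ^ e zero ∣_) (*-comm z y) (pᵉ∣x zero))))

  p∤yp₀ : ∀ i → p (suc i) ∤ y * p zero ^ e zero
  p∤yp₀ i pᵢ∣ with euclidsLemma y (p zero ^ e zero) (p-prime (suc i)) pᵢ∣
  ... | inj₁ pᵢ∣y = p∤y (suc i) pᵢ∣y
  ... | inj₂ pᵢ∣pᵉ with () ← p-inj (prime∣prime⇒≡ (p-prime (suc i)) (p-prime zero)
                                     (prime∣^⇒∣ (p-prime (suc i)) (e zero) pᵢ∣pᵉ))

-- The clique number in terms of halved exponents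

-- The modulus is the product of the ℓ i ^ (2 * k i) and of the
-- q j ^ (1 + 2 * h j). Either family of primes may be empty.
module HalvedExponents {r t : ℕ} (ℓ k : Fin r → ℕ) (q h : Fin t → ℕ)
  (ℓ-prime : ∀ i → Prime (ℓ i)) (q-prime : ∀ j → Prime (q j))
  (ℓ-inj : Injective _≡_ _≡_ ℓ) (q-inj : Injective _≡_ _≡_ q)
  (ℓ≢q : ∀ i j → ℓ i ≢ q j) (k≥1 : ∀ i → 1 ≤ k i) where

  open +-*-Solver

  -- A is the largest number whose square divides n, B is the square-free part
  -- of n, and M is the least number whose square is a multiple of n.
  A B M n : ℕ
  A = ∏ (λ i → ℓ i ^ k i) * ∏ (λ j → q j ^ h j)
  B = ∏ q
  M = A * B
  n = A * M

  instance
    A-nonZero : NonZero A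
    A-nonZero = m*n≢0 _ _ {{∏^-nonZero ℓ-prime k}} {{∏^-nonZero q-prime h}}

    B-nonZero : NonZero B
    B-nonZero = ∏-nonZero (λ j → prime⇒nonZero (q-prime j))

    M-nonZero : NonZero M
    M-nonZero = m*n≢0 A B

  n-factorisation : ∏ (λ i → ℓ i ^ (k i * 2)) * ∏ (λ j → q j ^ suc (h j * 2)) ≡ n
  n-factorisation = begin
    ∏ (λ i → ℓ i ^ (k i * 2)) * ∏ (λ j → q j ^ suc (h j * 2))
      ≡⟨ cong₂ _*_ (square ℓ k) (trans (∏-* q (λ j → q j ^ (h j * 2)))
                                       (cong (B *_) (square q h))) ⟩
    Lk * Lk * (B * (Qh * Qh))
      ≡⟨ solve 3 (λ l q b → l :* l :* (b :* (q :* q)) := l :* q :* (l :* q :* b)) refl Lk Qh B ⟩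
    n ∎
    where
    open ≡-Reasoning
    Lk = ∏ (λ i → ℓ i ^ k i)
    Qh = ∏ (λ j → q j ^ h j)
    square : ∀ {s} (p e : Fin s → ℕ) →
      ∏ (λ i → p i ^ (e i * 2)) ≡ ∏ (λ i → p i ^ e i) * ∏ (λ i → p i ^ e i)
    square p e = trans
      (∏-cong (λ i → trans (cong (p i ^_) (solve 1 (λ x → x :* con 2 := x :+ x) refl (e i)))
                           (^-distribˡ-+-* (p i) (e i) (e i))))
      (∏-* (λ i → p i ^ e i) (λ i → p i ^ e i))

  -- An index c of the first kind stands for the nonzero multiple M * (c + 1)
  -- of M, an index j of the second kind for the prime q j.
  Colour : Set
  Colour = Fin (A ∸ 1) ⊎ Fin t

  suc<A : (c : Fin (A ∸ 1)) → suc (toℕ c) < A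
  suc<A c = subst (suc (toℕ c) <_) (suc-pred A) (s≤s (toℕ<n c))

  colourIndex : ∀ {x} .{{_ : NonZero x}} → x < A → ∃[ c ] suc (toℕ {A ∸ 1} c) ≡ x
  colourIndex {suc x} x<A = fromℕ< x<A∸1 , cong suc (toℕ-fromℕ< x<A∸1)
    where
    x<A∸1 : x < A ∸ 1
    x<A∸1 = ≤-pred (subst (suc x <_) (sym (suc-pred A)) x<A)

  -- The clique

  -- w j is the product of the q i with i different from j.
  w : Fin t → ℕ
  w j = quotient (∣∏ q j)

  B≡w*q : ∀ j → B ≡ w j * q j
  B≡w*q j = _∣_.equality (∣∏ q j)

  w-nonZero : ∀ j → NonZero (w j)
  w-nonZero j = m*n≢0⇒m≢0 (w j) {{subst NonZero (B≡w*q j) B-nonZero}}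

  B∣w*w : ∀ {i j} → i ≢ j → B ∣ w i * w j
  B∣w*w {i} {j} i≢j
    with euclidsLemma (w i) (q i) (q-prime j) (subst (q j ∣_) (B≡w*q i) (∣∏ q j))
  ... | inj₁ qⱼ∣wᵢ = subst (_∣ w i * w j) (trans (*-comm (q j) (w j)) (sym (B≡w*q j)))
                       (*-monoˡ-∣ (w j) qⱼ∣wᵢ)
  ... | inj₂ qⱼ∣qᵢ = contradiction
                       (sym (q-inj (prime∣prime⇒≡ (q-prime j) (q-prime i) qⱼ∣qᵢ))) i≢j

  -- The representative below n of the clique member of each colour.
  val : Colour → ℕ
  val (inj₁ c) = M * suc (toℕ c)
  val (inj₂ j) = A * w j

  val-nonZero : ∀ κ → NonZero (val κ)
  val-nonZero (inj₁ c) = m*n≢0 M (suc (toℕ c))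
  val-nonZero (inj₂ j) = m*n≢0 A (w j) {{A-nonZero}} {{w-nonZero j}}

  val<n : ∀ κ → val κ < n
  val<n (inj₁ c) = subst (M * suc (toℕ c) <_) (*-comm M A) (*-monoʳ-< M (suc<A c))
  val<n (inj₂ j) = <-≤-trans (*-monoʳ-< A wⱼ<B) (m≤n*m M A)
    where
    wⱼ<B : w j < B
    wⱼ<B = subst (w j <_) (sym (B≡w*q j))
      (m<m*n (w j) (q j) {{w-nonZero j}} (nonTrivial⇒n>1 (q j) {{prime⇒nonTrivial (q-prime j)}}))

  multiple≢extra : ∀ c j → M * c ≢ A * w j
  multiple≢extra c j eq = prime-≢1 (q-prime j) (∣1⇒≡1 (divides c (sym c*q≡1)))
    where
    w*[c*q]≡w*1 : w j * (c * q j) ≡ w j * 1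
    w*[c*q]≡w*1 = begin
      w j * (c * q j) ≡⟨ solve 3 (λ w c q → w :* (c :* q) := w :* q :* c) refl (w j) c (q j) ⟩
      w j * q j * c   ≡⟨ cong (_* c) (B≡w*q j) ⟨
      B * c           ≡⟨ *-cancelˡ-≡ (B * c) (w j) A (trans (sym (*-assoc A B c)) eq) ⟩
      w j             ≡⟨ *-identityʳ (w j) ⟨
      w j * 1         ∎
      where open ≡-Reasoning
    c*q≡1 : c * q j ≡ 1
    c*q≡1 = *-cancelˡ-≡ (c * q j) 1 (w j) {{w-nonZero j}} w*[c*q]≡w*1

  w-injective : ∀ {i j} → w i ≡ w j → i ≡ j
  w-injective {i} {j} eq = q-inj (*-cancelˡ-≡ (q i) (q j) (w i) {{w-nonZero i}} (begin
    w i * q i ≡⟨ B≡w*q i ⟨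
    B         ≡⟨ B≡w*q j ⟩
    w j * q j ≡⟨ cong (_* q j) eq ⟨
    w i * q j ∎))
    where open ≡-Reasoning

  val-injective : ∀ {κ κ′} → val κ ≡ val κ′ → κ ≡ κ′
  val-injective {inj₁ c} {inj₁ d} eq =
    cong inj₁ (toℕ-injective (suc-injective (*-cancelˡ-≡ (suc (toℕ c)) (suc (toℕ d)) M eq)))
  val-injective {inj₁ c} {inj₂ j} eq = contradiction eq (multiple≢extra (suc (toℕ c)) j)
  val-injective {inj₂ i} {inj₁ d} eq = contradiction (sym eq) (multiple≢extra (suc (toℕ d)) i)
  val-injective {inj₂ i} {inj₂ j} eq = cong inj₂ (w-injective (*-cancelˡ-≡ (w i) (w j) A eq))

  n∣A*x*[A*y] : ∀ x y → B ∣ x * y → n ∣ A * x * (A * y)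
  n∣A*x*[A*y] x y B∣xy = subst (n ∣_)
    (solve 3 (λ a x y → a :* (a :* (x :* y)) := a :* x :* (a :* y)) refl A x y)
    (*-monoʳ-∣ A (*-monoʳ-∣ A B∣xy))

  n∣M*c*[A*y] : ∀ c y → n ∣ M * c * (A * y)
  n∣M*c*[A*y] c y = subst (λ z → n ∣ z * (A * y)) (sym (*-assoc A B c))
    (n∣A*x*[A*y] (B * c) y (∣m⇒∣m*n y (m∣m*n c)))

  val-adjacent : ∀ {κ κ′} → κ ≢ κ′ → n ∣ val κ * val κ′
  val-adjacent {inj₁ c} {inj₁ d} _ = subst (λ z → n ∣ M * suc (toℕ c) * z)
    (sym (*-assoc A B (suc (toℕ d)))) (n∣M*c*[A*y] (suc (toℕ c)) (B * suc (toℕ d)))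
  val-adjacent {inj₁ c} {inj₂ j} _ = n∣M*c*[A*y] (suc (toℕ c)) (w j)
  val-adjacent {inj₂ i} {inj₁ d} _ = subst (n ∣_) (*-comm (M * suc (toℕ d)) (A * w i))
    (n∣M*c*[A*y] (suc (toℕ d)) (w i))
  val-adjacent {inj₂ i} {inj₂ j} κ≢κ′ =
    n∣A*x*[A*y] (w i) (w j) (B∣w*w (κ≢κ′ ∘ cong inj₂))

  -- The colouring

  -- HasColour x κ says that κ is an admissible colour of x; an x that falls
  -- short of M at several primes has several admissible colours. Two colours
  -- are compared through any admissible reason, so no canonical choice of the
  -- prime is needed.
  data HasColour (x : ℕ) : Colour → Set where
    multiple  : ∀ {c} → x ≡ M * suc (toℕ c) → HasColour x (inj₁ c)
    evenPrime : ∀ {c} i → suc (toℕ c) * ℓ i ^ k i ≡ A → ℓ i ^ k i ∤ x →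
                HasColour x (inj₁ c)
    oddPrime  : ∀ {j} → q j ^ suc (h j) ∤ x → HasColour x (inj₂ j)

  ℓ∤∏q^ : ∀ i (e : Fin t → ℕ) → ℓ i ∤ ∏ (λ j → q j ^ e j)
  ℓ∤∏q^ i e ℓ∣ with j , ℓ≡q ← prime∣∏^⇒≡ q-prime (ℓ-prime i) e ℓ∣ = ℓ≢q i j ℓ≡q

  ℓ∤B : ∀ i → ℓ i ∤ B
  ℓ∤B i ℓ∣B with j , ℓ∣q ← prime∣∏⇒∣ (ℓ-prime i) q ℓ∣B =
    ℓ≢q i j (prime∣prime⇒≡ (ℓ-prime i) (q-prime j) ℓ∣q)

  ℓ∤A/ℓᵏ : ∀ i c → c * ℓ i ^ k i ≡ A → ℓ i ∤ c
  ℓ∤A/ℓᵏ i c eq ℓ∣c with d , ∏≡ℓᵏ*d , ℓ∤d ← ∏^-cofactor ℓ-prime ℓ-inj k i =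
    [ ℓ∤d , ℓ∤∏q^ i h ]′ (euclidsLemma d Qh (ℓ-prime i) (subst (ℓ i ∣_) c≡d*Qh ℓ∣c))
    where
    open ≡-Reasoning
    Qh = ∏ (λ j → q j ^ h j)
    c≡d*Qh : c ≡ d * Qh
    c≡d*Qh = *-cancelʳ-≡ c (d * Qh) (ℓ i ^ k i) {{prime^-nonZero (ℓ-prime i) (k i)}} (begin
      c * ℓ i ^ k i      ≡⟨ eq ⟩
      A                  ≡⟨ cong (_* Qh) ∏≡ℓᵏ*d ⟩
      ℓ i ^ k i * d * Qh ≡⟨ solve 3 (λ l d q → l :* d :* q := d :* q :* l) refl (ℓ i ^ k i) d Qh ⟩
      d * Qh * ℓ i ^ k i ∎)

  -- M * (A / ℓ i ^ k i) has exponent k i at ℓ i.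
  ℓᵏ⁺¹∤multiple : ∀ i c → c * ℓ i ^ k i ≡ A → ℓ i ^ suc (k i) ∤ M * c
  ℓᵏ⁺¹∤multiple i c eq ℓᵏ⁺¹∣ =
    [ ℓ∤c , (λ ℓ∣B*c → [ ℓ∤B i , ℓ∤c ]′ (euclidsLemma B c (ℓ-prime i) ℓ∣B*c)) ]′
      (euclidsLemma c (B * c) (ℓ-prime i)
        (*-cancelʳ-∣ (ℓ i ^ k i) {{prime^-nonZero (ℓ-prime i) (k i)}}
          (subst (ℓ i ^ suc (k i) ∣_) Mc≡ ℓᵏ⁺¹∣)))
    where
    ℓ∤c = ℓ∤A/ℓᵏ i c eq
    Mc≡ : M * c ≡ c * (B * c) * ℓ i ^ k i
    Mc≡ = trans (cong (λ z → z * B * c) (sym eq))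
      (solve 3 (λ c l b → c :* l :* b :* c := c :* (b :* c) :* l) refl c (ℓ i ^ k i) B)

  ℓᵏ∣A : ∀ i → ℓ i ^ k i ∣ A
  ℓᵏ∣A i = ∣m⇒∣m*n _ (∣∏ (λ i → ℓ i ^ k i) i)

  qʰ∣A : ∀ j → q j ^ h j ∣ A
  qʰ∣A j = ∣-trans (∣∏ (λ j → q j ^ h j) j) (n∣m*n (∏ (λ i → ℓ i ^ k i)))

  ℓ²ᵏ∣n : ∀ i → ℓ i ^ k i * ℓ i ^ k i ∣ n
  ℓ²ᵏ∣n i = *-pres-∣ (ℓᵏ∣A i) (∣m⇒∣m*n B (ℓᵏ∣A i))

  q²ʰ⁺¹∣n : ∀ j → q j ^ h j * q j ^ suc (h j) ∣ n
  q²ʰ⁺¹∣n j = *-pres-∣ (qʰ∣A j)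
    (subst (_∣ M) (*-comm (q j ^ h j) (q j)) (*-pres-∣ (qʰ∣A j) (∣∏ q j)))

  -- Since n is divisible by ℓ i ^ (2 * k i), an element of exponent less than
  -- k i at ℓ i is annihilated only by elements of exponent greater than k i.
  evenPrime-proper : ∀ i {x y} → n ∣ x * y → ℓ i ^ k i ∤ x → ℓ i ^ suc (k i) ∣ y
  evenPrime-proper i {x} n∣xy ∤x with k i | k≥1 i | ℓ²ᵏ∣n i
  ... | suc k′ | _ | ∣n = [ (λ ∣x → contradiction ∣x ∤x) , id ]′
    (primePower-split (ℓ-prime i) k′ (suc k′) x
      (∣-trans (∣-trans (∣-reflexive ℓ²ᵏ) ∣n) n∣xy))
    where
    ℓ²ᵏ = solve 2 (λ a l → a :* (l :* (l :* a)) := l :* a :* (l :* a)) refl (ℓ i ^ k′) (ℓ i)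

  -- Different primes of even exponent give different colours A / ℓ i ^ k i.
  A/ℓᵏ-unique : ∀ {i i′} c → c * ℓ i ^ k i ≡ A → c * ℓ i′ ^ k i′ ≡ A → i ≡ i′
  A/ℓᵏ-unique {i} {i′} c eq eq′ = ℓ-inj (prime∣prime⇒≡ (ℓ-prime i) (ℓ-prime i′)
    (prime∣^⇒∣ (ℓ-prime i) (k i′) (∣-trans ℓ∣ℓᵏ
      (∣-reflexive (*-cancelˡ-≡ _ _ c {{c≢0}} (trans eq (sym eq′)))))))
    where
    c≢0 : NonZero c
    c≢0 = m*n≢0⇒m≢0 c {{subst NonZero (sym eq) A-nonZero}}
    ℓ∣ℓᵏ : ℓ i ∣ ℓ i ^ k i
    ℓ∣ℓᵏ = subst (_∣ ℓ i ^ k i) (*-identityʳ (ℓ i)) (^-monoʳ-∣ (ℓ i) (k≥1 i))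

  -- Two different residues that share a colour do not annihilate each other.
  proper : ∀ {x y κ} → HasColour x κ → HasColour y κ → n ∣ x * y → x ≡ y
  proper (multiple eq) (multiple eq′) _ = trans eq (sym eq′)
  proper {x} {y} (multiple {c} refl) (evenPrime i eq ∤y) n∣xy = contradiction
    (evenPrime-proper i (subst (n ∣_) (*-comm x y) n∣xy) ∤y) (ℓᵏ⁺¹∤multiple i (suc (toℕ c)) eq)
  proper (evenPrime {c} i eq ∤x) (multiple refl) n∣xy =
    contradiction (evenPrime-proper i n∣xy ∤x) (ℓᵏ⁺¹∤multiple i (suc (toℕ c)) eq)
  proper {y = y} (evenPrime {c} i eq ∤x) (evenPrime i′ eq′ ∤y) n∣xy
    with refl ← A/ℓᵏ-unique (suc (toℕ c)) eq eq′ =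
    contradiction (∣-trans (n∣m*n (ℓ i)) (evenPrime-proper i n∣xy ∤x)) ∤y
  proper {x} (oddPrime {j} ∤x) (oddPrime ∤y) n∣xy =
    [ (λ ∣x → contradiction ∣x ∤x) , (λ ∣y → contradiction ∣y ∤y) ]′
      (primePower-split (q-prime j) (h j) (h j) x (∣-trans (q²ʰ⁺¹∣n j) n∣xy))

  M-∣ : ∀ {x} → (∀ i → ℓ i ^ k i ∣ x) → (∀ j → q j ^ suc (h j) ∣ x) → M ∣ x
  M-∣ {x} ℓᵏ∣x qʰ⁺¹∣x = subst (_∣ x) M≡
    (∏^-∣ q-prime q-inj (suc ∘ h) Lk∣x q∤Lk qʰ⁺¹∣x)
    where
    Lk = ∏ (λ i → ℓ i ^ k i)
    M≡ : Lk * ∏ (λ j → q j ^ suc (h j)) ≡ M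
    M≡ = trans (cong (Lk *_) (∏-* q (λ j → q j ^ h j)))
      (solve 3 (λ l b q → l :* (b :* q) := l :* q :* b) refl Lk B (∏ (λ j → q j ^ h j)))
    Lk∣x : Lk ∣ x
    Lk∣x = subst (_∣ x) (*-identityˡ Lk) (∏^-∣ ℓ-prime ℓ-inj k (1∣ x)
      (λ i ℓ∣1 → prime-≢1 (ℓ-prime i) (∣1⇒≡1 ℓ∣1)) ℓᵏ∣x)
    q∤Lk : ∀ j → q j ∤ Lk
    q∤Lk j q∣Lk with i , q≡ℓ ← prime∣∏^⇒≡ ℓ-prime (q-prime j) k q∣Lk = ℓ≢q i j (sym q≡ℓ)

  -- Divisibility by M is tested one prime power at a time, so that a failure
  -- comes with the prime that causes it.
  coloured : ∀ {x} → x ≢ 0 → x < n → ∃ (HasColour x)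
  coloured {x} x≢0 x<n with all? (λ i → ℓ i ^ k i ∣? x) | all? (λ j → q j ^ suc (h j) ∣? x)
  coloured {x} x≢0 x<n | no ¬∀ℓ | _
    with i , ℓᵏ∤x ← ¬∀⟶∃¬ r _ (λ i → ℓ i ^ k i ∣? x) ¬∀ℓ
    with divides d A≡d*ℓᵏ ← ℓᵏ∣A i =
    inj₁ (proj₁ c) , evenPrime i (trans (cong (_* ℓ i ^ k i) (proj₂ c)) (sym A≡d*ℓᵏ)) ℓᵏ∤x
    where
    d≢0 : NonZero d
    d≢0 = m*n≢0⇒m≢0 d {{subst NonZero A≡d*ℓᵏ A-nonZero}}
    1<ℓᵏ : 1 < ℓ i ^ k i
    1<ℓᵏ = ^-monoʳ-< (ℓ i) (nonTrivial⇒n>1 (ℓ i) {{prime⇒nonTrivial (ℓ-prime i)}}) (k≥1 i)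
    c = colourIndex {d} {{d≢0}}
      (subst (d <_) (sym A≡d*ℓᵏ) (m<m*n d (ℓ i ^ k i) {{d≢0}} 1<ℓᵏ))
  coloured {x} x≢0 x<n | yes _ | no ¬∀q
    with j , qʰ⁺¹∤x ← ¬∀⟶∃¬ t _ (λ j → q j ^ suc (h j) ∣? x) ¬∀q =
    inj₂ j , oddPrime qʰ⁺¹∤x
  coloured {x} x≢0 x<n | yes ∀ℓ | yes ∀q with divides d x≡d*M ← M-∣ ∀ℓ ∀q =
    inj₁ (proj₁ c) , multiple
      (trans x≡d*M (trans (*-comm d M) (cong (M *_) (sym (proj₂ c)))))
    where
    d≢0 : NonZero d
    d≢0 = ≢-nonZero (λ { refl → x≢0 x≡d*M })
    c = colourIndex {d} {{d≢0}} (*-cancelʳ-< M d A (subst (_< n) x≡d*M x<n))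

  isCliqueNumber : IsCliqueNumber (zeroDivisorGraph n) (A + t ∸ 1)
  isCliqueNumber = subst (IsCliqueNumber (zeroDivisorGraph n))
    (sym (+-∸-comm t (>-nonZero⁻¹ A)))
    (cliqueNumber-colouring (zeroDivisorGraph n) +↔⊎ vertex (proj₁ ∘ colour)
      vertex-adjacent colour-proper)
    where
    open SimpleGraph (zeroDivisorGraph n)

    vertex : Colour → Vertex
    vertex κ = fromℕ< (val<n κ) ,
      λ eq → ≢-nonZero⁻¹ (val κ) {{val-nonZero κ}} (trans (sym (toℕ-fromℕ< (val<n κ))) eq)

    toℕ-vertex : ∀ κ → toℕ (proj₁ (vertex κ)) ≡ val κ
    toℕ-vertex κ = toℕ-fromℕ< (val<n κ)

    vertex-adjacent : ∀ {κ κ′} → κ ≢ κ′ → vertex κ ~ vertex κ′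
    vertex-adjacent {κ} {κ′} κ≢κ′ =
      (λ eq → κ≢κ′ (val-injective (trans (sym (toℕ-vertex κ))
                     (trans (cong (toℕ ∘ proj₁) eq) (toℕ-vertex κ′))))) ,
      subst (n ∣_) (sym (cong₂ _*_ (toℕ-vertex κ) (toℕ-vertex κ′))) (val-adjacent κ≢κ′)

    colour : (x : Vertex) → ∃ (HasColour (toℕ (proj₁ x)))
    colour (x , x≢0) = coloured x≢0 (toℕ<n x)

    colour-proper : ∀ {x y} → proj₁ (colour x) ≡ proj₁ (colour y) → ¬ (x ~ y)
    colour-proper {x} {y} eq (x≢y , n∣xy) = x≢y (residue-injective (toℕ-injective
      (proper (subst (HasColour _) eq (proj₂ (colour x))) (proj₂ (colour y)) n∣xy)))

open HalvedExponents using (n-factorisation; isCliqueNumber)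

-- The three cases

even-/2 : ∀ {m} → Even m → m ≡ m / 2 * 2
even-/2 2∣m = sym (m/n*n≡m 2∣m)

even-/2≥1 : ∀ {m} → Even m → 1 ≤ m → 1 ≤ m / 2
even-/2≥1 {m} 2∣m 1≤m = >-nonZero⁻¹ (m / 2)
  {{m*n≢0⇒m≢0 (m / 2) {{subst NonZero (even-/2 2∣m) (>-nonZero 1≤m)}}}}

even-or-suc-even : ∀ m → Even m ⊎ Even (suc m)
even-or-suc-even zero    = inj₁ (divides 0 refl)
even-or-suc-even (suc m) =
  [ (λ even → inj₂ (∣m∣n⇒∣m+n ∣-refl even)) , inj₁ ]′ (even-or-suc-even m)

odd-∸1 : ∀ {m} → Odd m → m ≡ suc ((m ∸ 1) / 2 * 2)
odd-∸1 {zero}  odd = contradiction (divides 0 refl) odd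
odd-∸1 {suc m} odd =
  [ (λ even → cong suc (even-/2 even)) , (λ even → contradiction even odd) ]′
    (even-or-suc-even m)

strictlyIncreasing⇒injective : ∀ {s} {p : Fin s → ℕ} →
  (∀ i j → i Fin.< j → p i < p j) → Injective _≡_ _≡_ p
strictlyIncreasing⇒injective p-mono {i} {j} eq with Fin.<-cmp i j
... | tri< i<j _ _ = contradiction eq (ℕ.<⇒≢ (p-mono i j i<j))
... | tri≈ _ i≡j _ = i≡j
... | tri> _ _ j<i = contradiction (sym eq) (ℕ.<⇒≢ (p-mono j i j<i))

squareFree⇒exponent≡1 : ∀ {n p e} → SquareFree n → Prime p → 1 ≤ e → p ^ e ∣ n → e ≡ 1
squareFree⇒exponent≡1 {e = 1} _ _ _ _ = refl
squareFree⇒exponent≡1 {p = p} {suc (suc e)} sqf pr _ pᵉ∣n = contradiction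
  (sqf (∣-trans (subst (p * p ∣_) (*-assoc p p (p ^ e)) (m∣m*n (p ^ e))) pᵉ∣n))
  (prime-≢1 pr)

module _ {n s} {p α : Fin s → ℕ} (p-prime : ∀ i → Prime (p i))
  (p-inj : Injective _≡_ _≡_ p) (α≥1 : ∀ i → 1 ≤ α i)
  (n≡ : n ≡ ∏ (λ i → p i ^ α i)) where

  -- All exponents are 1 = 1 + 2 * 0. The empty family ℓ of primes is also used
  -- as its family of exponents.
  squareFree-case : SquareFree n → IsCliqueNumber (zeroDivisorGraph n) s
  squareFree-case sqf = subst₂ (λ m → IsCliqueNumber (zeroDivisorGraph m)) modulus order
    (isCliqueNumber ℓ ℓ p h (λ ()) p-prime (λ {}) p-inj (λ ()) (λ ()))
    where
    ℓ : Fin 0 → ℕ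
    ℓ ()
    h : Fin s → ℕ
    h _ = 0
    α≡1 : ∀ i → α i ≡ 1
    α≡1 i = squareFree⇒exponent≡1 sqf (p-prime i) (α≥1 i)
      (subst (p i ^ α i ∣_) (sym n≡) (∣∏ (λ i → p i ^ α i) i))
    modulus = trans
      (sym (n-factorisation ℓ ℓ p h (λ ()) p-prime (λ {}) p-inj (λ ()) (λ ())))
      (trans (*-identityˡ _) (trans (∏-cong (λ i → cong (p i ^_) (sym (α≡1 i)))) (sym n≡)))
    order = cong (λ a → a + s ∸ 1) (trans (*-identityˡ _) (∏-1 s))

  -- Here the family q of primes of odd exponent is empty, and is also used as
  -- its family of exponents.
  even-case : (∀ i → Even (α i)) →
    IsCliqueNumber (zeroDivisorGraph n) (∏ (λ i → p i ^ (α i / 2)) ∸ 1)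
  even-case even = subst₂ (λ m → IsCliqueNumber (zeroDivisorGraph m)) modulus order
    (isCliqueNumber p k q q p-prime (λ ()) p-inj (λ {}) (λ _ ()) k≥1)
    where
    q : Fin 0 → ℕ
    q ()
    k : Fin s → ℕ
    k i = α i / 2
    k≥1 : ∀ i → 1 ≤ k i
    k≥1 i = even-/2≥1 (even i) (α≥1 i)
    modulus = trans
      (sym (n-factorisation p k q q p-prime (λ ()) p-inj (λ {}) (λ _ ()) k≥1))
      (trans (*-identityʳ (∏ (λ i → p i ^ (k i * 2))))
        (trans (∏-cong (λ i → cong (p i ^_) (sym (even-/2 (even i))))) (sym n≡)))
    order = cong (_∸ 1) (trans (+-identityʳ (Pk * 1)) (*-identityʳ Pk))
      where Pk = ∏ (λ i → p i ^ k i)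

mixed-case : ∀ {n r t} {ℓ δ : Fin r → ℕ} {q β : Fin t → ℕ} →
  PrimesWithExponent Even n ℓ δ → PrimesWithExponent Odd n q β →
  n ≡ ∏ (λ i → ℓ i ^ δ i) * ∏ (λ j → q j ^ β j) →
  IsCliqueNumber (zeroDivisorGraph n)
    (∏ (λ i → ℓ i ^ (δ i / 2)) * ∏ (λ j → q j ^ ((β j ∸ 1) / 2)) + t ∸ 1)
mixed-case {n} {ℓ = ℓ} {δ} {q} {β} evens odds n≡ =
  subst (λ m → IsCliqueNumber (zeroDivisorGraph m) _) modulus
    (isCliqueNumber ℓ k q h E.prime O.prime E.distinct O.distinct ℓ≢q k≥1)
  where
  module E = PrimesWithExponent evens
  module O = PrimesWithExponent odds
  k = λ i → δ i / 2
  h = λ j → (β j ∸ 1) / 2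
  k≥1 : ∀ i → 1 ≤ k i
  k≥1 i = even-/2≥1 (E.property i) (E.positive i)
  ℓ≢q : ∀ i j → ℓ i ≢ q j
  ℓ≢q i j ℓ≡q = O.property j (subst Even
    (∥-unique (subst (λ x → x ^ δ i ∥ n) ℓ≡q (E.exponent i)) (O.exponent j)) (E.property i))
  modulus = trans
    (sym (n-factorisation ℓ k q h E.prime O.prime E.distinct O.distinct ℓ≢q k≥1))
    (trans (cong₂ _*_ (∏-cong (λ i → cong (ℓ i ^_) (sym (even-/2 (E.property i)))))
                      (∏-cong (λ j → cong (q j ^_) (sym (odd-∸1 (O.property j))))))
           (sym n≡))

theorem2 : (n s : ℕ) (p α : Fin s → ℕ) →
    1 ≤ s →
    (∀ i → Prime (p i)) →
    (∀ i j → i Fin.< j → p i < p j) →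
    (∀ i → 1 ≤ α i) →
    n ≡ ∏ (λ i → p i ^ α i) →
    (SquareFree n →
    IsCliqueNumber (zeroDivisorGraph n) s)
    ×
    ((∀ i → Even (α i)) →
    IsCliqueNumber (zeroDivisorGraph n) (∏ (λ i → p i ^ (α i / 2)) ∸ 1))
    ×
    (¬ SquareFree n →
    ¬ (∀ i → Even (α i)) →
    (r t : ℕ) (ℓ δ : Fin r → ℕ) (q β : Fin t → ℕ) →
    1 ≤ t →
    PrimesWithExponent Even n ℓ δ →
    PrimesWithExponent Odd n q β →
    n ≡ ∏ (λ i → ℓ i ^ δ i) * ∏ (λ j → q j ^ β j) →
    IsCliqueNumber (zeroDivisorGraph n)
    (∏ (λ i → ℓ i ^ (δ i / 2)) * ∏ (λ j → q j ^ ((β j ∸ 1) / 2)) + t ∸ 1))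
theorem2 n s p α _ p-prime p-mono α≥1 n≡ =
  squareFree-case p-prime p-inj α≥1 n≡ ,
  even-case p-prime p-inj α≥1 n≡ ,
  λ _ _ _ _ _ _ _ _ _ evens odds n≡′ → mixed-case evens odds n≡′
  where
  p-inj : Injective _≡_ _≡_ p
  p-inj = strictlyIncreasing⇒injective p-mono
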